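{- Let $A_3$ be an antichain (poset) with $|A_3|=3$. Then for every integer $k\ge 1$, we have $s_3(k)=|J^{k-1}(A_3)|$. Moreover, for every integer $k\ge 5$, \[ (\operatorname{twr}_{k-2}(2))^2 \le s_3(k)=|J^{k-1}(A_3)|\le \frac{\operatorname{twr}_{k-1}(2)}{2}. \]
   Context: Write $[n]=\{1,\dots,n\}$ and let $\binom{[N]}{k}$ denote the set of $k$-element subsets of $[N]$. For integers $N,k\ge 1$, the shift graph $\operatorname{Sh}(N,k)$ is the directed graph with vertex set $\binom{[N]}{k}$ in which, for all $x_1<x_2<\cdots<x_{k+1}$ in $[N]$, there is an arc $\{x_1,\ldots,x_k\}\to\{x_2,\ldots,x_{k+1}\}$ (and no other arcs). Its chromatic number $\chi(\operatorname{Sh}(N,k))$ is that of the underlying undirected graph. The $3$-color shift number is $s_3(k)=\max\{N:\chi(\operatorname{Sh}(N,k))\le 3\}$ (this maximum exists, since for fixed $k$ Ramsey's theorem gives $\chi(\operatorname{Sh}(N,k))\to\infty$ as $N\to\infty$). For a poset $Q$, a down-set is a subset $S\subseteq Q$ such that $y\in S$ and $x\le y$ imply $x\in S$ (the empty set is a down-set). $J(Q)$ is the poset of all down-sets of $Q$ ordered by inclusion; $J^0(Q)=Q$ and $J^i(Q)=J(J^{i-1}(Q))$ for $i\ge 1$. $|Q|$ is the number of elements of $Q$. An antichain is a set of pairwise incomparable elements; $A_3$ is viewed as the poset consisting of three pairwise incomparable elements. The tower function is defined by $\operatorname{twr}_1(x)=x$ and $\operatorname{twr}_{i+1}(x)=2^{\operatorname{twr}_i(x)}$.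 -}

module Defs where

open import Data.Bool.Base using (Bool; true; false; T)
open import Data.Empty using (⊥-elim)
open import Data.Fin.Base using (Fin; inject₁) renaming (suc to fsuc; _<_ to _<ᶠ_)
open import Data.Fin.Subset using (Subset; ⁅_⁆; ⋃; ∣_∣)
open import Data.List.Base using (tabulate)
open import Data.Nat.Base using (ℕ; zero; suc; _^_; _≤_)
open import Data.Product.Base using (Σ; ∃-syntax; _×_; proj₁)
open import Data.Sum.Base using (_⊎_)
open import Data.Unit.Base using (tt)
open import Function.Base using (_∘_)
open import Function.Bundles using (Inverse)
open import Level using (0ℓ)
open import Relation.Binary.Bundles using (Poset)
open import Relation.Binary.Core using (_Preserves_⟶_)
open import Relation.Binary.PropositionalEquality
  using (_≡_; _≢_; _≗_; refl; sym; trans; subst; setoid)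
open import Relation.Nullary.Negation using (¬_)
open import Relation.Unary using (Pred)

IsLeast : Pred ℕ 0ℓ → Pred ℕ 0ℓ
IsLeast P m = P m × (∀ n → P n → m ≤ n)

IsGreatest : Pred ℕ 0ℓ → Pred ℕ 0ℓ
IsGreatest P m = P m × (∀ n → P n → n ≤ m)

record Digraph : Set₁ where
  field
    Vertex : Set
    Arc    : Vertex → Vertex → Set

  Adjacent : Vertex → Vertex → Set
  Adjacent u v = Arc u v ⊎ Arc v u

Colourable : Digraph → ℕ → Set
Colourable G m = Σ (Vertex → Fin m) λ c → ∀ u v → Adjacent u v → c u ≢ c v
  where open Digraph G

IsChromaticNumber : Digraph → ℕ → Set
IsChromaticNumber G = IsLeast (Colourable G)

image : ∀ {n N} → (Fin n → Fin N) → Subset N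
image x = ⋃ (tabulate (⁅_⁆ ∘ x))

-- The ground set [N] is Fin N; only its order matters.
Sh : ℕ → ℕ → Digraph
Sh N k = record
  { Vertex = Σ (Subset N) (λ S → ∣ S ∣ ≡ k)
  ; Arc    = λ S T → Σ (Fin (suc k) → Fin N) λ x →
               x Preserves _<ᶠ_ ⟶ _<ᶠ_
               × proj₁ S ≡ image (x ∘ inject₁)
               × proj₁ T ≡ image (x ∘ fsuc)
  }

-- IsShiftNumber₃ k s says that s₃(k) exists and equals s.
IsShiftNumber₃ : ℕ → ℕ → Set
IsShiftNumber₃ k = IsGreatest λ N →
  1 ≤ N × ∃[ χ ] (IsChromaticNumber (Sh N k) χ × χ ≤ 3)

IsAntichain : Poset 0ℓ 0ℓ 0ℓ → Set
IsAntichain Q = ∀ x y → ¬ x ≈ y → ¬ x ⊑ y × ¬ y ⊑ x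
  where open Poset Q renaming (_≤_ to _⊑_)

-- Elements are counted up to the equality _≈_ of the poset.
HasCardinality : Poset 0ℓ 0ℓ 0ℓ → ℕ → Set
HasCardinality Q n = Inverse (Poset.Eq.setoid Q) (setoid (Fin n))

-- Subsets are Bool-valued, which covers all subsets of the finite posets
-- considered here and keeps DownSet Q in the same universe as Q, so that the
-- construction can be iterated.  Closure under _≤_ includes closure under _≈_.
record DownSet (Q : Poset 0ℓ 0ℓ 0ℓ) : Set where
  open Poset Q renaming (_≤_ to _⊑_)
  field
    member : Carrier → Bool
    closed : ∀ {x y} → x ⊑ y → T (member y) → T (member x)

open DownSet

T-antisym : ∀ {a b} → (T a → T b) → (T b → T a) → a ≡ b
T-antisym {false} {false} f g = refl
T-antisym {false} {true}  f g = ⊥-elim (g tt)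
T-antisym {true}  {false} f g = ⊥-elim (f tt)
T-antisym {true}  {true}  f g = refl

-- Two down-sets are equal when they have the same elements.
J : Poset 0ℓ 0ℓ 0ℓ → Poset 0ℓ 0ℓ 0ℓ
J Q = record
  { Carrier = DownSet Q
  ; _≈_ = λ S S′ → member S ≗ member S′
  ; _≤_ = λ S S′ → ∀ x → T (member S x) → T (member S′ x)
  ; isPartialOrder = record
    { isPreorder = record
      { isEquivalence = record
        { refl  = λ _ → refl
        ; sym   = λ p x → sym (p x)
        ; trans = λ p q x → trans (p x) (q x)
        }
      ; reflexive = λ p x → subst T (p x)
      ; trans     = λ p q x → q x ∘ p x
      }
    ; antisym = λ p q x → T-antisym (p x) (q x)
    }
  }

J^ : ℕ → Poset 0ℓ 0ℓ 0ℓ → Poset 0ℓ 0ℓ 0ℓ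
J^ zero    Q = Q
J^ (suc i) Q = J (J^ i Q)

-- twr i x is indexed from i = 1; the value at i = 0 is a dummy.
twr : ℕ → ℕ → ℕ
twr zero          x = 0
twr (suc zero)    x = x
twr (suc (suc i)) x = 2 ^ twr (suc i) x

{-# OPTIONS --safe #-}

-- For a poset Q let D(Q) be the digraph with x → y iff x ⋢ y; for an antichain
-- this is a complete graph, so a colouring of Sh(N,k) is a homomorphism into
-- D(A).  Since Sh(N,k+1) is the arc graph of Sh(N,k), homomorphisms
-- Sh(N,k+1) → D(Q) and Sh(N,k) → D(J Q) determine each other: a vertex v goes to
-- the set S(v) of elements of Q that lie above no image of an arc into v, and
-- conversely an arc u → v goes to an element of S(u) outside S(v).  After k-1 steps one is left
-- with sequences q₁,…,q_N in J^{k-1}(A) such that q_i ⋢ q_j for i < j, which exist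
-- iff N ≤ |J^{k-1}(A)| by a reversed linear extension.
--
-- The upper bound iterates |J Q| ≤ 2^|Q| from |J⁴(A₃)| = 8573.  For the lower
-- bound, |J Q| is split by the number of elements of a down-set: some size class
-- has at least |J Q| / (|Q| + 1) members, and being an antichain in J Q it yields
-- that many independent choices in J(J Q).
module Submission where

open import Defs
open import Data.Bool.Base using (Bool; false; T)
open import Data.Bool.Properties using (T-≡; T?)
open import Data.Empty using (⊥-elim)
open import Data.Fin.Base as Fin using (Fin; zero; suc)
import Data.Fin.Properties as Fin
open import Data.Fin.Subset using (Subset; inside; outside; _∈_; _⊆_; ∣_∣; ⁅_⁆; ⋃)
open import Data.Fin.Subset.Properties
  using (_⊆?_; ⊆-refl; ⊆-reflexive; drop-∷-⊆; ∉⊥; _∈?_; ∣p∣≤n; p⊆q⇒∣p∣≤∣q∣;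
    x∈p∪q⁺; x∈p∪q⁻; x∈⁅x⁆; x∈⁅y⁆⇒x≡y; anySubset?)
open import Data.List.Base as List using (List; []; _∷_; _++_; filter; length)
import Data.List.Properties as List
open import Data.List.Membership.Propositional using () renaming (_∈_ to _∈ₗ_)
open import Data.List.Membership.Propositional.Properties as Membership
  using (∈-++⁺ˡ; ∈-++⁺ʳ; ∈-++⁻; ∈-map⁺; ∈-map⁻; ∈-filter⁺; ∈-filter⁻; ∈-lookup)
import Data.List.Relation.Binary.Sublist.Propositional.Properties as Sublist
open import Data.List.Relation.Unary.All as All using (All; []; _∷_)
import Data.List.Relation.Unary.All.Properties as All
open import Data.List.Relation.Unary.AllPairs as AllPairs using (AllPairs; []; _∷_)
import Data.List.Relation.Unary.AllPairs.Properties as AllPairs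
open import Data.List.Relation.Unary.Any as Any using (here; there)
import Data.List.Relation.Unary.Any.Properties as Any
open import Data.Nat.Base
  using (ℕ; zero; suc; _+_; _*_; _≤_; _<_; _∸_; _^_; _/_; z≤n; s≤s)
open import Data.Nat.DivMod using (/-monoˡ-≤; m*n/n≡m)
import Data.Nat.Properties as ℕ
open import Data.Product.Base using (Σ; ∃; ∃-syntax; _×_; _,_; proj₁; proj₂)
open import Data.Sum.Base using (inj₁; inj₂)
open import Data.Vec.Base as Vec using (Vec; []; _∷_; here; there)
import Data.Vec.Properties as Vec
open import Data.Vec.Relation.Unary.Linked as Linked using (Linked; []; [-]; _∷_; linked?)
import Data.Vec.Relation.Unary.Linked.Properties as Linked
open import Function.Base using (_∘_)
open import Function.Bundles using (Inverse; Equivalence; _⇔_; mk⇔)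
import Function.Construct.Identity as Identity
open import Level using (0ℓ)
open import Relation.Binary.Bundles using (Poset)
open import Relation.Binary.Core using (_Preserves_⟶_)
open import Relation.Binary.Definitions using (tri<; tri≈; tri>)
open import Relation.Binary.Properties.Setoid using (≈-poset)
open import Relation.Binary.PropositionalEquality
  using (_≡_; _≢_; _≗_; refl; sym; trans; cong; cong₂; subst; subst₂; setoid; module ≡-Reasoning)
open import Relation.Nullary.Decidable
  using (Dec; yes; no; ⌊_⌋; map′; _×-dec_; ¬?; decidable-stable; toWitness; fromWitness)
open import Relation.Nullary.Negation using (¬_; contradiction)

open DownSet

-- Finite orders and the list of their down-sets

-- A finite partial order whose points are listed so that no point lies below a
-- later one; each row is the set of those later points that lie below the
-- point it belongs to.
data FiniteOrder : ℕ → Set where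
  []  : FiniteOrder 0
  _∷_ : ∀ {n} → Subset n → FiniteOrder n → FiniteOrder (suc n)

-- The principal down-set of a point. Rows are arbitrary subsets, so transitivity is inherited from
-- the poset matched by a `Realisation`.
below : ∀ {n} → FiniteOrder n → Fin n → Subset n
below (b ∷ t) zero    = inside ∷ b
below (b ∷ t) (suc i) = outside ∷ below t i

below-refl : ∀ {n} (t : FiniteOrder n) i → i ∈ below t i
below-refl (b ∷ t) zero    = here
below-refl (b ∷ t) (suc i) = there (below-refl t i)

below⇒≥ : ∀ {n} (t : FiniteOrder n) {i j} → i ∈ below t j → j Fin.≤ i
below⇒≥ (b ∷ t) {i}     {zero}  _         = z≤n
below⇒≥ (b ∷ t) {suc i} {suc j} (there p) = s≤s (below⇒≥ t p)

antichain : ∀ n → FiniteOrder n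
antichain zero    = []
antichain (suc n) = Vec.replicate n outside ∷ antichain n

below-antichain : ∀ n {i j} → i ∈ below (antichain n) j → i ≡ j
below-antichain (suc n) {zero}  {zero}  _         = refl
below-antichain (suc n) {suc i} {zero}  (there p) = contradiction p ∉⊥
below-antichain (suc n) {suc i} {suc j} (there p) = cong suc (below-antichain n p)

Closed : ∀ {n} → FiniteOrder n → Subset n → Set
Closed t v = ∀ {i} → i ∈ v → below t i ⊆ v

-- A separate function, so that the list is evaluated only once.
extend : ∀ {n} → Subset n → List (Subset n) → List (Subset (suc n))
extend b l = List.map (inside ∷_) (filter (b ⊆?_) l) ++ List.map (outside ∷_) l

-- The first point lies below no other point, so it may be left out of any down-set; putting it in
-- forces exactly its row `b` into the rest. Sets with the first point come first in the list, which
-- fixes the order used in `downs-ordered`.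
downs : ∀ {n} → FiniteOrder n → List (Subset n)
downs []      = [] ∷ []
downs (b ∷ t) = extend b (downs t)

∈-downs⁺ : ∀ {n} (t : FiniteOrder n) {v} → Closed t v → v ∈ₗ downs t
∈-downs⁺ []      {[]} _ = here refl
∈-downs⁺ (b ∷ t) {s ∷ v} c = cases s c
  where
  tail-closed : ∀ {s} → Closed (b ∷ t) (s ∷ v) → Closed t v
  tail-closed c i∈v = drop-∷-⊆ (c (there i∈v))
  cases : ∀ s → Closed (b ∷ t) (s ∷ v) → (s ∷ v) ∈ₗ downs (b ∷ t)
  cases inside  c = ∈-++⁺ˡ (∈-map⁺ _ (∈-filter⁺ (b ⊆?_) (∈-downs⁺ t (tail-closed c)) (drop-∷-⊆ (c here))))
  cases outside c = ∈-++⁺ʳ _ (∈-map⁺ _ (∈-downs⁺ t (tail-closed c)))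

∈-downs⁻ : ∀ {n} (t : FiniteOrder n) {v} → v ∈ₗ downs t → Closed t v
∈-downs⁻ [] _ {()}
∈-downs⁻ (b ∷ t) v∈ i∈v j∈ with ∈-++⁻ (List.map (inside ∷_) (filter (b ⊆?_) (downs t))) v∈
... | inj₁ v∈₁ with ∈-map⁻ (inside ∷_) v∈₁
...   | w , w∈₁ , refl = go i∈v j∈
  where
  w∈ : w ∈ₗ downs t × b ⊆ w
  w∈ = ∈-filter⁻ (b ⊆?_) w∈₁
  go : ∀ {i j} → i ∈ (inside ∷ w) → j ∈ below (b ∷ t) i → j ∈ (inside ∷ w)
  go here      here      = here
  go here      (there p) = there (proj₂ w∈ p)
  go (there q) (there p) = there (∈-downs⁻ t (proj₁ w∈) q p)
∈-downs⁻ (b ∷ t) v∈ i∈v j∈ | inj₂ v∈₂ with ∈-map⁻ (outside ∷_) v∈₂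
∈-downs⁻ (b ∷ t) v∈ (there i∈w) (there j∈) | inj₂ _ | w , w∈ , refl =
  there (∈-downs⁻ t w∈ i∈w j∈)

_⊈_ : ∀ {n} → Subset n → Subset n → Set
u ⊈ v = ¬ u ⊆ v

-- Between the two blocks an inclusion fails at the first point; within a block, induct on the
-- tails. This is the listing convention of `FiniteOrder`, so the down-sets form such an order
-- again, and it also rules out repetitions.
downs-ordered : ∀ {n} (t : FiniteOrder n) → AllPairs _⊈_ (downs t)
downs-ordered []      = [] ∷ []
downs-ordered (b ∷ t) =
  AllPairs.++⁺ (cons (AllPairs.filter⁺ (b ⊆?_) rec)) (cons rec)
    (All.map⁺ (All.universal (λ _ → All.map⁺ (All.universal (λ _ → in⊈out) _)) _))
  where
  rec : AllPairs _⊈_ (downs t)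
  rec = downs-ordered t
  cons : ∀ {m s} {l : List (Subset m)} → AllPairs _⊈_ l → AllPairs _⊈_ (List.map (s ∷_) l)
  cons = AllPairs.map⁺ ∘ AllPairs.map (λ u⊈v su⊆sv → u⊈v (drop-∷-⊆ su⊆sv))
  in⊈out : ∀ {m} {u v : Subset m} → (inside ∷ u) ⊈ (outside ∷ v)
  in⊈out p with () ← p here

inclusion : ∀ {n} (l : List (Subset n)) → FiniteOrder (length l)
inclusion []      = []
inclusion (v ∷ l) = Vec.tabulate (λ i → ⌊ List.lookup l i ⊆? v ⌋) ∷ inclusion l

∈-tabulate⁺ : ∀ {n} (f : Fin n → Bool) {i} → T (f i) → i ∈ Vec.tabulate f
∈-tabulate⁺ f {i} p =
  Vec.lookup⇒[]= i _ (trans (Vec.lookup∘tabulate f i) (Equivalence.to T-≡ p))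

∈-tabulate⁻ : ∀ {n} (f : Fin n → Bool) {i} → i ∈ Vec.tabulate f → T (f i)
∈-tabulate⁻ f {i} p =
  Equivalence.from T-≡ (trans (sym (Vec.lookup∘tabulate f i)) (Vec.[]=⇒lookup p))

inclusion⁺ : ∀ {n} {l : List (Subset n)} → AllPairs _⊈_ l → ∀ {i j} →
             List.lookup l i ⊆ List.lookup l j → i ∈ below (inclusion l) j
inclusion⁺ (_ ∷ _)  {zero}  {zero}  _ = here
inclusion⁺ {l = v ∷ l} (_ ∷ _) {suc i} {zero} p =
  there (∈-tabulate⁺ (λ i → ⌊ List.lookup l i ⊆? v ⌋) (fromWitness (λ {x} → p {x})))
inclusion⁺ (v⊈ ∷ _) {zero}  {suc j} p = ⊥-elim (All.lookup v⊈ (∈-lookup j) p)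
inclusion⁺ (_ ∷ ps) {suc i} {suc j} p = there (inclusion⁺ ps p)

inclusion⁻ : ∀ {n} (l : List (Subset n)) {i j} →
             i ∈ below (inclusion l) j → List.lookup l i ⊆ List.lookup l j
inclusion⁻ (v ∷ l) {zero}  {zero}  _ = ⊆-refl
inclusion⁻ (v ∷ l) {suc i} {zero}  (there p) =
  toWitness (∈-tabulate⁻ (λ i → ⌊ List.lookup l i ⊆? v ⌋) p)
inclusion⁻ (v ∷ l) {suc i} {suc j} (there p) = inclusion⁻ l p

-- Posets realised by finite orders

-- An order isomorphism up to `_≈_`. Injectivity of `at` is derived: equivalent values lie below
-- each other, and `below⇒≥` then bounds each index by the other.
record Realisation {n : ℕ} (t : FiniteOrder n) (Q : Poset 0ℓ 0ℓ 0ℓ) : Set where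
  open Poset Q using (Carrier; _≈_; module Eq; reflexive; antisym) renaming (_≤_ to _⊑_; trans to ⊑-trans)
  field
    at       : Fin n → Carrier
    index    : Carrier → Fin n
    at-index : ∀ q → at (index q) ≈ q
    below⇒⊑  : ∀ {i j} → i ∈ below t j → at i ⊑ at j
    ⊑⇒below  : ∀ {i j} → at i ⊑ at j → i ∈ below t j

  at-injective : ∀ {i j} → at i ≈ at j → i ≡ j
  at-injective p = Fin.≤-antisym (below⇒≥ t (⊑⇒below (reflexive (Eq.sym p))))
                                 (below⇒≥ t (⊑⇒below (reflexive p)))

  index-at : ∀ i → index (at i) ≡ i
  index-at i = at-injective (at-index (at i))

  index-injective : ∀ {x y} → index x ≡ index y → x ≈ y
  index-injective {x} {y} p =
    Eq.trans (Eq.sym (at-index x)) (subst (λ i → at i ≈ y) (sym p) (at-index y))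

  index-cong : ∀ {x y} → x ≈ y → index x ≡ index y
  index-cong {x} {y} x≈y =
    at-injective (Eq.trans (at-index x) (Eq.trans x≈y (Eq.sym (at-index y))))

  index-mono : ∀ {x y} → x ⊑ y → index x ∈ below t (index y)
  index-mono {x} {y} x⊑y = ⊑⇒below (⊑-trans (reflexive (at-index x))
                                   (⊑-trans x⊑y (reflexive (Eq.sym (at-index y)))))

  index-reflects : ∀ {x y} → index x ∈ below t (index y) → x ⊑ y
  index-reflects {x} {y} p = ⊑-trans (reflexive (Eq.sym (at-index x)))
                                     (⊑-trans (below⇒⊑ p) (reflexive (at-index y)))

  -- Membership in a down-set is Bool-valued, so every down-set built from the order later on has to
  -- rest on a decision of `_⊑_`.
  _⊑?_ : ∀ x y → Dec (x ⊑ y)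
  x ⊑? y = map′ index-reflects index-mono (index x ∈? below t (index y))

  cardinality : HasCardinality Q n
  cardinality = record
    { to        = index
    ; from      = at
    ; to-cong   = index-cong
    ; from-cong = λ { refl → Eq.refl }
    ; inverse   = (λ { {x} {y} y≈ → trans (index-cong y≈) (index-at x) })
                , (λ { {x} {y} refl → at-index x })
    }

module _ {n} {t : FiniteOrder n} {Q : Poset 0ℓ 0ℓ 0ℓ} (r : Realisation t Q) where
  open Poset Q using (Carrier) renaming (_≤_ to _⊑_)
  open Realisation r

  toSubset : DownSet Q → Subset n
  toSubset D = Vec.tabulate (member D ∘ at)

  toSubset-closed : ∀ D → Closed t (toSubset D)
  toSubset-closed D i∈ j∈ =
    ∈-tabulate⁺ (member D ∘ at) (closed D (below⇒⊑ j∈) (∈-tabulate⁻ (member D ∘ at) i∈))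

  fromSubset : (v : Subset n) → Closed t v → DownSet Q
  fromSubset v c = record
    { member = λ q → Vec.lookup v (index q)
    ; closed = λ x⊑y y∈ → from∈ (c (to∈ y∈) (index-mono x⊑y))
    }
    where
    to∈ : ∀ {i} → T (Vec.lookup v i) → i ∈ v
    to∈ {i} p = Vec.lookup⇒[]= i v (Equivalence.to T-≡ p)
    from∈ : ∀ {i} → i ∈ v → T (Vec.lookup v i)
    from∈ p = Equivalence.from T-≡ (Vec.[]=⇒lookup p)

  fromSubset-mono : ∀ {u v} (c : Closed t u) (d : Closed t v) → u ⊆ v →
                    Poset._≤_ (J Q) (fromSubset u c) (fromSubset v d)
  fromSubset-mono c d u⊆v q p = Equivalence.from T-≡
    (Vec.[]=⇒lookup (u⊆v (Vec.lookup⇒[]= (index q) _ (Equivalence.to T-≡ p))))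

  fromSubset-reflects : ∀ {u v} (c : Closed t u) (d : Closed t v) →
                        Poset._≤_ (J Q) (fromSubset u c) (fromSubset v d) → u ⊆ v
  fromSubset-reflects {u} {v} c d p {i} i∈u = Vec.lookup⇒[]= i v (Equivalence.to T-≡
    (subst (T ∘ Vec.lookup v) (index-at i) (p (at i)
      (subst (T ∘ Vec.lookup u) (sym (index-at i))
        (Equivalence.from T-≡ (Vec.[]=⇒lookup i∈u))))))

  J-realisation : Realisation (inclusion (downs t)) (J Q)
  J-realisation = record
    { at       = λ k → fromSubset _ (lookup-closed k)
    ; index    = λ D → Any.index (position D)
    ; at-index = λ D q →
        trans (cong (λ v → Vec.lookup v (index q)) (sym (Any.lookup-index (position D))))
          (trans (Vec.lookup∘tabulate (member D ∘ at) (index q))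
            (member-cong D (at-index q)))
    ; below⇒⊑  = λ {i} {j} p → fromSubset-mono (lookup-closed i) (lookup-closed j) (inclusion⁻ (downs t) p)
    ; ⊑⇒below  = λ {i} {j} p → inclusion⁺ (downs-ordered t)
                              (fromSubset-reflects (lookup-closed i) (lookup-closed j) p)
    }
    where
    lookup-closed : ∀ k → Closed t (List.lookup (downs t) k)
    lookup-closed k = ∈-downs⁻ t (∈-lookup k)
    position : ∀ D → toSubset D ∈ₗ downs t
    position D = ∈-downs⁺ t (toSubset-closed D)
    member-cong : ∀ (D : DownSet Q) {x y} → Poset._≈_ Q x y → member D x ≡ member D y
    member-cong D x≈y = T-antisym (closed D (Poset.reflexive Q (Poset.Eq.sym Q x≈y)))
                                  (closed D (Poset.reflexive Q x≈y))

next : ∃ FiniteOrder → ∃ FiniteOrder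
next (n , t) = length (downs t) , inclusion (downs t)

-- Concrete data for the i-th iterate of `J` on an m-element antichain, so that its size can be
-- computed. The parameter m is kept general because it becomes the number of colours.
order : ℕ → ℕ → ∃ FiniteOrder
order m zero    = m , antichain m
order m (suc i) = next (order m i)

size : ℕ → ℕ → ℕ
size m i = proj₁ (order m i)

module _ {m} (Q : Poset 0ℓ 0ℓ 0ℓ) (anti : IsAntichain Q) (card : HasCardinality Q m) where
  open Poset Q using (module Eq; reflexive)
  open Inverse card using (to; from; inverse)

  antichain-realisation : Realisation (antichain m) Q
  antichain-realisation = record
    { at       = from
    ; index    = to
    ; at-index = λ q → proj₂ inverse refl
    ; below⇒⊑  = λ {i} {j} p → reflexive
        (subst (λ k → Poset._≈_ Q (from i) (from k)) (below-antichain m p) Eq.refl)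
    ; ⊑⇒below  = λ {i} {j} p → comparable i j p
    }
    where
    comparable : ∀ i j → Poset._≤_ Q (from i) (from j) → i ∈ below (antichain m) j
    comparable i j p with i Fin.≟ j
    ... | yes refl = below-refl (antichain m) i
    ... | no  i≢j  = contradiction p (proj₁ (anti (from i) (from j)
      (λ eq → i≢j (trans (sym (proj₁ inverse Eq.refl)) (proj₁ inverse eq)))))

  realisation : ∀ i → Realisation (proj₂ (order m i)) (J^ i Q)
  realisation zero    = antichain-realisation
  realisation (suc i) = J-realisation (realisation i)

-- Bounds on the number of down-sets

length-downs≤ : ∀ {n} (t : FiniteOrder n) → length (downs t) ≤ 2 ^ n
length-downs≤ []      = s≤s z≤n
length-downs≤ {suc n} (b ∷ t) = begin
  length (extend b (downs t))
    ≡⟨ List.length-++ (List.map (inside ∷_) (filter (b ⊆?_) (downs t))) ⟩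
  length (List.map (inside ∷_) (filter (b ⊆?_) (downs t))) + length (List.map (outside ∷_) (downs t))
    ≡⟨ cong₂ _+_ (List.length-map _ (filter (b ⊆?_) (downs t))) (List.length-map _ (downs t)) ⟩
  length (filter (b ⊆?_) (downs t)) + length (downs t)
    ≤⟨ ℕ.+-mono-≤ (ℕ.≤-trans (List.length-filter (b ⊆?_) (downs t)) (length-downs≤ t)) (length-downs≤ t) ⟩
  2 ^ n + 2 ^ n
    ≡⟨ cong (2 ^ n +_) (ℕ.+-identityʳ (2 ^ n)) ⟨
  2 ^ suc n ∎
  where open ℕ.≤-Reasoning

funToFin-cong : ∀ {m n} {f g : Fin m → Fin n} → f ≗ g → Fin.funToFin f ≡ Fin.funToFin g
funToFin-cong {zero}  f≗g = refl
funToFin-cong {suc m} f≗g = cong₂ Fin.combine (f≗g zero) (funToFin-cong (f≗g ∘ suc))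

finToFun-injective : ∀ m n {a b : Fin (n ^ m)} → Fin.finToFun {n} {m} a ≗ Fin.finToFun b → a ≡ b
finToFun-injective m n {a} {b} p =
  trans (sym (Fin.funToFin-finToFin {m} {n} a)) (trans (funToFin-cong p) (Fin.funToFin-finToFin {m} {n} b))

bit-ext : (a b : Fin 2) → (a ≡ suc zero → b ≡ suc zero) → (b ≡ suc zero → a ≡ suc zero) → a ≡ b
bit-ext zero       zero       _ _ = refl
bit-ext zero       (suc zero) _ g = g refl
bit-ext (suc zero) zero       f _ = sym (f refl)
bit-ext (suc zero) (suc zero) _ _ = refl

-- Every subset of the antichain generates a down-set, and the antichain members in that down-set
-- are exactly the chosen ones. Subsets are coded as maps into `Fin 2`, that is, as elements of
-- `Fin (2 ^ w)`.
antichain⇒2^≤ : ∀ {n w} {t : FiniteOrder n} {Q : Poset 0ℓ 0ℓ 0ℓ} → Realisation t Q →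
  (f : Fin w → Poset.Carrier Q) → (∀ {i j} → Poset._≤_ Q (f i) (f j) → i ≡ j) →
  2 ^ w ≤ length (downs t)
antichain⇒2^≤ {w = w} {t} {Q} r f f-antichain =
  Fin.injective⇒≤ {f = λ a → index (down (Fin.finToFun a))} λ p →
    finToFun-injective w 2 (down-injective p)
  where
  open Poset Q using (Carrier) renaming (_≤_ to _⊑_)
  open Realisation r using (_⊑?_)
  open Realisation (J-realisation r) using (index; index-injective)

  Below : (Fin w → Fin 2) → Carrier → Set
  Below X q = ∃[ j ] (X j ≡ suc zero × q ⊑ f j)

  below? : ∀ X q → Dec (Below X q)
  below? X q = Fin.any? (λ j → (X j Fin.≟ suc zero) ×-dec (q ⊑? f j))

  down : (Fin w → Fin 2) → DownSet Q
  down X = record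
    { member = λ q → ⌊ below? X q ⌋
    ; closed = λ x⊑y y∈ → let j , Xj , y⊑ = toWitness y∈ in
        fromWitness (j , Xj , Poset.trans Q x⊑y y⊑)
    }

  transfer : ∀ {X Y} → Poset._≈_ (J Q) (down X) (down Y) → ∀ j → X j ≡ suc zero → Y j ≡ suc zero
  transfer {X} {Y} eq j Xj with toWitness {a? = below? Y (f j)}
    (subst T (eq (f j)) (fromWitness (j , Xj , Poset.refl Q)))
  ... | k , Yk , j⊑k = trans (cong Y (f-antichain j⊑k)) Yk

  down-injective : ∀ {X Y} → index (down X) ≡ index (down Y) → X ≗ Y
  down-injective {X} {Y} p j =
    bit-ext (X j) (Y j) (transfer eq j) (transfer (sym ∘ eq) j)
    where
    eq : Poset._≈_ (J Q) (down X) (down Y)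
    eq = index-injective {down X} {down Y} p

-- By enumeration: the sizes run 3, 8, 20, 84, 8573, where 20 counts the monotone Boolean functions
-- of three variables.
size₃₃ : size 3 3 ≡ 84
size₃₃ = refl

size₃₄ : size 3 4 ≡ 8573
size₃₄ = refl

length≤filter+filter¬ : ∀ {A : Set} {P : A → Set} (P? : ∀ x → Dec (P x)) xs →
  length xs ≤ length (filter P? xs) + length (filter (¬? ∘ P?) xs)
length≤filter+filter¬ P? []       = z≤n
length≤filter+filter¬ P? (x ∷ xs) with P? x | length≤filter+filter¬ P? xs
... | yes _ | ih = s≤s ih
... | no  _ | ih = ℕ.≤-trans (s≤s ih) (ℕ.≤-reflexive (sym (ℕ.+-suc _ _)))

-- Induction on the largest value: if its class has fewer than `w` members, removing it leaves
-- enough elements for the remaining `suc m` values.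
pigeonhole : ∀ {A : Set} (g : A → ℕ) (w m : ℕ) xs → All (λ x → g x ≤ m) xs →
  suc m * w ≤ length xs → ∃[ c ] w ≤ length (filter (λ x → g x ℕ.≟ c) xs)
pigeonhole g w zero xs g≤0 w≤ = 0 ,
  subst (λ ys → w ≤ length ys) (sym (List.filter-all (λ x → g x ℕ.≟ 0) (All.map ℕ.n≤0⇒n≡0 g≤0)))
    (subst (_≤ length xs) (ℕ.+-identityʳ w) w≤)
pigeonhole {A} g w (suc m) xs g≤ many with w ℕ.≤? length (filter (λ x → g x ℕ.≟ suc m) xs)
... | yes w≤ = suc m , w≤
... | no  w≰ with pigeonhole g w m rest rest≤ rest-many
  where
  top? : ∀ x → Dec (g x ≡ suc m)
  top? x = g x ℕ.≟ suc m
  rest : List A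
  rest = filter (¬? ∘ top?) xs
  rest≤ : All (λ x → g x ≤ m) rest
  rest≤ = All.zipWith (λ { (≤1+m , ≢1+m) → ℕ.≤-pred (ℕ.≤∧≢⇒< ≤1+m ≢1+m) })
    (All.filter⁺ (¬? ∘ top?) g≤ , All.all-filter (¬? ∘ top?) xs)
  rest-many : suc m * w ≤ length rest
  rest-many = ℕ.+-cancelˡ-≤ w (suc m * w) (length rest)
    (ℕ.≤-trans many (ℕ.≤-trans (length≤filter+filter¬ top? xs)
      (ℕ.+-monoˡ-≤ (length rest) (ℕ.<⇒≤ (ℕ.≰⇒> w≰)))))
...   | c , w≤ = c , ℕ.≤-trans w≤ (Sublist.length-mono-≤
    (Sublist.filter⁺ (λ x → g x ℕ.≟ c) (λ x → g x ℕ.≟ c) (λ { refl p → p })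
      (Sublist.filter-⊆ (λ x → ¬? (g x ℕ.≟ suc m)) xs)))

⊆∧∣∣≡⇒≡ : ∀ {n} {u v : Subset n} → u ⊆ v → ∣ u ∣ ≡ ∣ v ∣ → u ≡ v
⊆∧∣∣≡⇒≡ {u = []}          {[]}          _ _ = refl
⊆∧∣∣≡⇒≡ {u = inside ∷ u}  {inside ∷ v}  p e = cong (inside ∷_) (⊆∧∣∣≡⇒≡ (drop-∷-⊆ p) (ℕ.suc-injective e))
⊆∧∣∣≡⇒≡ {u = outside ∷ u} {outside ∷ v} p e = cong (outside ∷_) (⊆∧∣∣≡⇒≡ (drop-∷-⊆ p) e)
⊆∧∣∣≡⇒≡ {u = inside ∷ u}  {outside ∷ v} p e with () ← p here
⊆∧∣∣≡⇒≡ {u = outside ∷ u} {inside ∷ v}  p e =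
  contradiction (subst (_≤ ∣ v ∣) e (p⊆q⇒∣p∣≤∣q∣ {p = u} {v} (drop-∷-⊆ p))) ℕ.1+n≰n

lookup-AllPairs : ∀ {A : Set} {R : A → A → Set} {l : List A} → AllPairs R l →
  ∀ {i j} → i Fin.< j → R (List.lookup l i) (List.lookup l j)
lookup-AllPairs (Rx ∷ _) {zero}  {suc j} _         = All.lookup Rx (∈-lookup j)
lookup-AllPairs (_ ∷ Rs) {suc i} {suc j} (s≤s i<j) = lookup-AllPairs Rs i<j

-- Down-sets with equally many elements form an antichain.
2^≤∣JJ∣ : ∀ {n} {t : FiniteOrder n} {Q : Poset 0ℓ 0ℓ 0ℓ} → Realisation t Q →
  ∀ w → suc n * w ≤ length (downs t) → 2 ^ w ≤ length (downs (inclusion (downs t)))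
2^≤∣JJ∣ {n} {t} {Q} r w many with pigeonhole ∣_∣ w n (downs t) (All.universal ∣p∣≤n (downs t)) many
... | c , w≤ = ℕ.≤-trans (ℕ.^-monoʳ-≤ 2 w≤) (antichain⇒2^≤ (J-realisation r) level level-antichain)
  where
  ∣∣≟c : ∀ v → Dec (∣ v ∣ ≡ c)
  ∣∣≟c v = ∣ v ∣ ℕ.≟ c

  sets : List (Subset n)
  sets = filter ∣∣≟c (downs t)

  sets-closed : ∀ j → Closed t (List.lookup sets j)
  sets-closed j = ∈-downs⁻ t (proj₁ (∈-filter⁻ ∣∣≟c {xs = downs t} (∈-lookup j)))

  sets-card : ∀ j → ∣ List.lookup sets j ∣ ≡ c
  sets-card j = proj₂ (∈-filter⁻ ∣∣≟c {xs = downs t} (∈-lookup j))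

  sets-ordered : ∀ {i j} → i Fin.< j → List.lookup sets i ⊈ List.lookup sets j
  sets-ordered = lookup-AllPairs (AllPairs.filter⁺ ∣∣≟c (downs-ordered t))

  level : Fin (length sets) → DownSet Q
  level j = fromSubset r (List.lookup sets j) (sets-closed j)

  level-antichain : ∀ {i j} → Poset._≤_ (J Q) (level i) (level j) → i ≡ j
  level-antichain {i} {j} p with Fin.<-cmp i j
  ... | tri≈ _ i≡j _ = i≡j
  ... | tri< i<j _ _ = ⊥-elim (sets-ordered i<j (fromSubset-reflects r (sets-closed i) (sets-closed j) p))
  -- `sets-ordered` excludes inclusion in an order of indices opposite to this one; equal size turns
  -- the inclusion into an equality, which can be reversed.
  ... | tri> _ _ j<i = ⊥-elim (sets-ordered j<i (⊆-reflexive (sym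
    (⊆∧∣∣≡⇒≡ (fromSubset-reflects r (sets-closed i) (sets-closed j) p)
             (trans (sets-card i) (sym (sets-card j)))))))

-- Tower bounds

-- A concrete antichain of every size, through which facts about `size` and about colourings with
-- any number of colours are obtained.
discrete : ℕ → Poset 0ℓ 0ℓ 0ℓ
discrete m = ≈-poset (setoid (Fin m))

discrete-antichain : ∀ m → IsAntichain (discrete m)
discrete-antichain m x y x≢y = x≢y , x≢y ∘ sym

discrete-cardinality : ∀ m → HasCardinality (discrete m) m
discrete-cardinality m = Identity.inverse (setoid (Fin m))

-- Here s i = |Jⁱ(A₃)|; keeping s abstract prevents the evaluation of s 5.
module TowerBounds (s : ℕ → ℕ) (s₃ : s 3 ≡ 84) (s₄ : s 4 ≡ 8573)
  (s≤2^ : ∀ i → s (suc i) ≤ 2 ^ s i)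
  (2^≤s : ∀ i w → suc (s i) * w ≤ s (suc i) → 2 ^ w ≤ s (suc (suc i))) where

  -- The bound is on s + 1 instead of s because `lower` has to fit s + 1 size classes under the
  -- tower.
  upper : ∀ j → 2 * suc (s (4 + j)) ≤ twr (4 + j) 2
  upper zero    = subst (λ a → 2 * suc a ≤ 65536) (sym s₄) (toWitness {a? = 2 * 8574 ℕ.≤? 65536} _)
  upper (suc j) = begin
    2 * suc (s (5 + j))  ≤⟨ ℕ.*-monoʳ-≤ 2 (s≤s (s≤2^ (4 + j))) ⟩
    2 * suc (2 ^ a)      ≤⟨ ℕ.*-monoʳ-≤ 2 (ℕ.+-monoˡ-≤ (2 ^ a) (ℕ.m^n>0 2 a)) ⟩
    2 * (2 ^ a + 2 ^ a)  ≡⟨ cong (λ x → 2 * (2 ^ a + x)) (ℕ.+-identityʳ (2 ^ a)) ⟨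
    2 ^ (2 + a)          ≤⟨ ℕ.^-monoʳ-≤ 2 (ℕ.+-mono-≤ (s≤s (z≤n {a})) (ℕ.m≤m+n (suc a) 0)) ⟩
    2 ^ (2 * suc a)      ≤⟨ ℕ.^-monoʳ-≤ 2 (upper j) ⟩
    twr (5 + j) 2        ∎
    where
    open ℕ.≤-Reasoning
    a : ℕ
    a = s (4 + j)

  -- The square of 2 ^ τ is 2 ^ (2τ), so a size class with 2τ members is wanted. With a + 1 classes
  -- this needs (a + 1) · 2τ ≤ τ², which is `upper`, and τ² ≤ s (5 + j), which is the induction
  -- hypothesis.
  lower : ∀ j → twr (3 + j) 2 ^ 2 ≤ s (4 + j)
  lower zero          = subst (256 ≤_) (sym s₄) (toWitness {a? = 256 ℕ.≤? 8573} _)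
  -- The general step would need 2 · 85 ≤ 16 here, which fails. Instead 85 · 32 ≤ 8573 is used, with
  -- 65536² = 2 ^ 32.
  lower (suc zero)    = 2^≤s 3 32
    (subst₂ (λ a b → suc a * 32 ≤ b) (sym s₃) (sym s₄) (toWitness {a? = 85 * 32 ℕ.≤? 8573} _))
  lower (suc (suc j)) = begin
    (2 ^ τ) ^ 2  ≡⟨ ℕ.^-*-assoc 2 τ 2 ⟩
    2 ^ (τ * 2)  ≤⟨ 2^≤s (4 + j) (τ * 2) (many (lower (suc j))) ⟩
    s (6 + j)    ∎
    where
    open ℕ.≤-Reasoning
    τ a : ℕ
    τ = twr (4 + j) 2
    a = s (4 + j)
    many : τ ^ 2 ≤ s (5 + j) → suc a * (τ * 2) ≤ s (5 + j)
    many τ²≤ = begin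
      suc a * (τ * 2)  ≡⟨ cong (suc a *_) (ℕ.*-comm τ 2) ⟩
      suc a * (2 * τ)  ≡⟨ ℕ.*-assoc (suc a) 2 τ ⟨
      suc a * 2 * τ    ≡⟨ cong (_* τ) (ℕ.*-comm (suc a) 2) ⟩
      2 * suc a * τ    ≤⟨ ℕ.*-monoˡ-≤ τ (upper j) ⟩
      τ * τ            ≡⟨ cong (τ *_) (ℕ.*-identityʳ τ) ⟨
      τ ^ 2            ≤⟨ τ²≤ ⟩
      s (5 + j)        ∎

open TowerBounds (size 3) size₃₃ size₃₄
  (λ i → length-downs≤ (proj₂ (order 3 i)))
  (λ i → 2^≤∣JJ∣ (realisation (discrete 3) (discrete-antichain 3) (discrete-cardinality 3) i))

-- Shift homomorphisms

Increasing : ∀ {N k} → Vec (Fin N) k → Set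
Increasing = Linked Fin._<_

-- Arcs of the shift graph go from init w to tail w for increasing w; they are
-- sent to arcs of the digraph on Q with x → y iff x ⋢ y.
ShiftHom : ℕ → ℕ → Poset 0ℓ 0ℓ 0ℓ → Set
ShiftHom N k Q = Σ (Vec (Fin N) (suc k) → Carrier) λ f →
  ∀ {w : Vec (Fin N) (suc (suc k))} → Increasing w → ¬ f (Vec.init w) ⊑ f (Vec.tail w)
  where open Poset Q using (Carrier) renaming (_≤_ to _⊑_)

init-increasing : ∀ {N k} {w : Vec (Fin N) (suc k)} → Increasing w → Increasing (Vec.init w)
init-increasing [-]             = []
init-increasing (_ ∷ [-])       = [-]
init-increasing (x<y ∷ y<z ∷ p) = x<y ∷ init-increasing (y<z ∷ p)

module _ {n N : ℕ} {t : FiniteOrder n} {Q : Poset 0ℓ 0ℓ 0ℓ} (r : Realisation t Q) where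
  open Poset Q using (Carrier; module Eq; reflexive) renaming (_≤_ to _⊑_)
  open Realisation r

  shiftHom-J : ∀ {k} → ShiftHom N (suc k) Q → ShiftHom N k (J Q)
  shiftHom-J {k} (f , f-hom) = avoids , avoids-hom
    where
    Avoids : Vec (Fin N) (suc k) → Carrier → Set
    Avoids v q = ∀ y → ¬ (Increasing (y ∷ v) × f (y ∷ v) ⊑ q)

    avoids? : ∀ v q → Dec (Avoids v q)
    avoids? v q = Fin.all? (λ y → ¬? (linked? Fin._<?_ (y ∷ v) ×-dec (f (y ∷ v) ⊑? q)))

    avoids : Vec (Fin N) (suc k) → DownSet Q
    avoids v = record
      { member = λ q → ⌊ avoids? v q ⌋
      ; closed = λ p⊑q q∈ → fromWitness λ y → λ { (inc , f⊑p) →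
          toWitness q∈ y (inc , Poset.trans Q f⊑p p⊑q) }
      }

    avoids-hom : ∀ {w} → Increasing w → ¬ Poset._≤_ (J Q) (avoids (Vec.init w)) (avoids (Vec.tail w))
    avoids-hom {x ∷ v} inc init⊑tail =
      toWitness {a? = avoids? v q} (init⊑tail q (fromWitness q∈init)) x (inc , Poset.refl Q)
      where
      -- The image of the arc `x ∷ v` itself separates the two sets: the arc enters `v`, so `q` is
      -- not avoided there.
      q : Carrier
      q = f (x ∷ v)
      q∈init : Avoids (Vec.init (x ∷ v)) q
      -- Any arc from `y` into the initial vertex is followed by `x ∷ v`, and `f` respects
      -- consecutive arcs.
      q∈init y (inc′ , f⊑q) = f-hom {y ∷ x ∷ v} (lower-first inc′ inc) f⊑q
        where
        lower-first : ∀ {k y x} {v : Vec (Fin N) (suc k)} →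
          Increasing (y ∷ Vec.init (x ∷ v)) → Increasing (x ∷ v) → Increasing (y ∷ x ∷ v)
        lower-first (y<x ∷ _) p = y<x ∷ p

  -- The implication sits under the existential so that the choice is total: where there is no
  -- separating element, `default` is returned.
  separate : Carrier → (D E : DownSet Q) →
    ∃[ q ] (¬ Poset._≤_ (J Q) D E → T (member D q) × ¬ T (member E q))
  separate default D E
    with Fin.any? (λ i → T? (member D (at i)) ×-dec ¬? (T? (member E (at i))))
  ... | yes (i , i∈D , i∉E) = at i , λ _ → i∈D , i∉E
  ... | no ¬sep = default , λ D⊈E → contradiction included D⊈E
    where
    included : Poset._≤_ (J Q) D E
    included q q∈D = closed E (reflexive (Eq.sym (at-index q)))
      (decidable-stable (T? _) λ q∉E →
        ¬sep (index q , closed D (reflexive (at-index q)) q∈D , q∉E))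

  -- Consecutive arcs share a middle vertex. Its down-set omits the value of the incoming arc and
  -- contains that of the outgoing one, so closure forbids the first from lying below the second.
  shiftHom-J⁻ : ∀ {k} → Carrier → ShiftHom N k (J Q) → ShiftHom N (suc k) Q
  shiftHom-J⁻ {k} default (S , S-hom) = f , f-hom
    where
    f : Vec (Fin N) (suc (suc k)) → Carrier
    f w = proj₁ (separate default (S (Vec.init w)) (S (Vec.tail w)))

    f-sep : ∀ w → Increasing w →
      T (member (S (Vec.init w)) (f w)) × ¬ T (member (S (Vec.tail w)) (f w))
    f-sep w inc = proj₂ (separate default (S (Vec.init w)) (S (Vec.tail w))) (S-hom inc)

    f-hom : ∀ {w} → Increasing w → ¬ f (Vec.init w) ⊑ f (Vec.tail w)
    f-hom {x ∷ y ∷ v} inc fi⊑ft =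
      proj₂ (f-sep (Vec.init (x ∷ y ∷ v)) (init-increasing inc))
        (closed (S (Vec.init (y ∷ v))) fi⊑ft (proj₁ (f-sep (y ∷ v) (Linked.tail inc))))

  -- For single letters every pair x < y is an arc, and reflexivity keeps the values distinct.
  shiftHom⇒≤ : ShiftHom N 0 Q → N ≤ n
  shiftHom⇒≤ (f , f-hom) = Fin.injective⇒≤ {f = λ x → index (f (x ∷ []))} injective
    where
    injective : ∀ {x y} → index (f (x ∷ [])) ≡ index (f (y ∷ [])) → x ≡ y
    injective {x} {y} p with Fin.<-cmp x y
    ... | tri≈ _ x≡y _ = x≡y
    ... | tri< x<y _ _ = contradiction (reflexive (index-injective p)) (f-hom (x<y ∷ [-]))
    ... | tri> _ _ y<x = contradiction (reflexive (index-injective (sym p))) (f-hom (y<x ∷ [-]))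

  -- The listing `at` never puts a point below a later one, so its first `N` points serve.
  ≤⇒shiftHom : N ≤ n → ShiftHom N 0 Q
  ≤⇒shiftHom N≤n = (λ v → at (Fin.inject≤ (Vec.head v) N≤n)) , hom
    where
    hom : ∀ {w} → Increasing w →
      ¬ at (Fin.inject≤ (Vec.head (Vec.init w)) N≤n) ⊑ at (Fin.inject≤ (Vec.head (Vec.tail w)) N≤n)
    hom {x ∷ y ∷ []} (x<y ∷ _) p = ℕ.<⇒≱ x<y
      (subst₂ _≤_ (Fin.toℕ-inject≤ y N≤n) (Fin.toℕ-inject≤ x N≤n) (below⇒≥ t (⊑⇒below p)))

module _ {m} (Q : Poset 0ℓ 0ℓ 0ℓ) (anti : IsAntichain Q) (card : HasCardinality Q (suc m)) where
  private
    r : ∀ i → Realisation (proj₂ (order (suc m) i)) (J^ i Q)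
    r = realisation Q anti card

  J^-default : ∀ i → Poset.Carrier (J^ i Q)
  J^-default zero    = Inverse.from card zero
  J^-default (suc i) = record { member = λ _ → false ; closed = λ _ () }

  shiftHom-J^ : ∀ {N} k i → ShiftHom N k (J^ i Q) → ShiftHom N 0 (J^ (k + i) Q)
  shiftHom-J^     zero    i h = h
  shiftHom-J^ {N} (suc k) i h = subst (λ j → ShiftHom N 0 (J^ j Q)) (ℕ.+-suc k i)
    (shiftHom-J^ k (suc i) (shiftHom-J (r i) h))

  shiftHom-J^⁻ : ∀ {N} k i → ShiftHom N 0 (J^ (k + i) Q) → ShiftHom N k (J^ i Q)
  shiftHom-J^⁻     zero    i h = h
  shiftHom-J^⁻ {N} (suc k) i h = shiftHom-J⁻ (r i) (J^-default i)
    (shiftHom-J^⁻ k (suc i) (subst (λ j → ShiftHom N 0 (J^ j Q)) (sym (ℕ.+-suc k i)) h))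

  shiftHom⇔ : ∀ {N} k → ShiftHom N k Q ⇔ N ≤ size (suc m) k
  shiftHom⇔ {N} k = mk⇔
    (λ h → shiftHom⇒≤ (r k) (subst (λ j → ShiftHom N 0 (J^ j Q)) (ℕ.+-identityʳ k) (shiftHom-J^ k 0 h)))
    (λ le → shiftHom-J^⁻ k 0 (subst (λ j → ShiftHom N 0 (J^ j Q)) (sym (ℕ.+-identityʳ k)) (≤⇒shiftHom (r k) le)))

-- Colourings of the shift graph

elements : ∀ {N} → Subset N → List (Fin N)
elements []            = []
elements (inside  ∷ S) = zero ∷ List.map suc (elements S)
elements (outside ∷ S) = List.map suc (elements S)

length-elements : ∀ {N} (S : Subset N) → length (elements S) ≡ ∣ S ∣
length-elements []            = refl
length-elements (inside  ∷ S) = cong suc (trans (List.length-map suc (elements S)) (length-elements S))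
length-elements (outside ∷ S) = trans (List.length-map suc (elements S)) (length-elements S)

∈-elements⁺ : ∀ {N} {S : Subset N} {i} → i ∈ S → i ∈ₗ elements S
∈-elements⁺ here = here refl
∈-elements⁺ {S = inside  ∷ S} (there i∈) = there (∈-map⁺ suc (∈-elements⁺ i∈))
∈-elements⁺ {S = outside ∷ S} (there i∈) = ∈-map⁺ suc (∈-elements⁺ i∈)

∈-elements⁻ : ∀ {N} (S : Subset N) {i} → i ∈ₗ elements S → i ∈ S
∈-elements⁻ (inside  ∷ S) (here refl) = here
∈-elements⁻ (inside  ∷ S) (there i∈) with ∈-map⁻ suc i∈
... | _ , j∈ , refl = there (∈-elements⁻ S j∈)
∈-elements⁻ (outside ∷ S) i∈ with ∈-map⁻ suc i∈
... | _ , j∈ , refl = there (∈-elements⁻ S j∈)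

elements-sorted : ∀ {N} (S : Subset N) → AllPairs Fin._<_ (elements S)
elements-sorted []            = []
elements-sorted (inside  ∷ S) = All.map⁺ (All.universal (λ _ → s≤s z≤n) (elements S))
                              ∷ AllPairs.map⁺ (AllPairs.map s≤s (elements-sorted S))
elements-sorted (outside ∷ S) = AllPairs.map⁺ (AllPairs.map s≤s (elements-sorted S))

sorted-unique : ∀ {N} {xs ys : List (Fin N)} → AllPairs Fin._<_ xs → AllPairs Fin._<_ ys →
  (∀ {i} → i ∈ₗ xs → i ∈ₗ ys) → (∀ {i} → i ∈ₗ ys → i ∈ₗ xs) → xs ≡ ys
sorted-unique []      []      _ _ = refl
sorted-unique []      (_ ∷ _) _ g with () ← g (here refl)
sorted-unique (_ ∷ _) []      f _ with () ← f (here refl)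
sorted-unique {xs = x ∷ xs} {y ∷ ys} (x< ∷ xs-sorted) (y< ∷ ys-sorted) f g =
  cong₂ _∷_ x≡y (sorted-unique xs-sorted ys-sorted
    (λ i∈ → strip (All.lookup x< i∈) x≡y (f (there i∈)))
    (λ i∈ → strip (All.lookup y< i∈) (sym x≡y) (g (there i∈))))
  where
  strip : ∀ {a b i l} → a Fin.< i → a ≡ b → i ∈ₗ (b ∷ l) → i ∈ₗ l
  strip a<i refl (here refl) = contradiction a<i (Fin.<-irrefl refl)
  strip _   _    (there i∈)  = i∈
  x≡y : x ≡ y
  x≡y with f (here refl) | g (here refl)
  ... | here eq  | _        = eq
  ... | there _  | here eq  = sym eq
  -- Each head would be smaller than the other.
  ... | there x∈ | there y∈ = contradiction (All.lookup x< y∈) (Fin.<-asym (All.lookup y< x∈))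

∈-image⁺ : ∀ {n N} (x : Fin n → Fin N) j → x j ∈ image x
∈-image⁺ x zero    = x∈p∪q⁺ (inj₁ (x∈⁅x⁆ (x zero)))
∈-image⁺ x (suc j) = x∈p∪q⁺ {p = ⁅ x zero ⁆} (inj₂ (∈-image⁺ (x ∘ suc) j))

∈-image⁻ : ∀ {n N} (x : Fin n → Fin N) {i} → i ∈ image x → ∃[ j ] i ≡ x j
∈-image⁻ {zero}  x i∈ = contradiction i∈ ∉⊥
∈-image⁻ {suc n} x i∈ with x∈p∪q⁻ ⁅ x zero ⁆ (image (x ∘ suc)) i∈
... | inj₁ i∈₁ = zero , x∈⁅y⁆⇒x≡y (x zero) i∈₁
... | inj₂ i∈₂ with j , eq ← ∈-image⁻ (x ∘ suc) i∈₂ = suc j , eq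

image-cong : ∀ {n N} {x y : Fin n → Fin N} → x ≗ y → image x ≡ image y
image-cong x≗y = cong ⋃ (List.tabulate-cong (cong ⁅_⁆ ∘ x≗y))

module _ {n N} {x : Fin n → Fin N} (x-mono : x Preserves Fin._<_ ⟶ Fin._<_) where

  elements-image : elements (image x) ≡ List.tabulate x
  elements-image = sorted-unique (elements-sorted (image x)) (AllPairs.tabulate⁺-< x-mono)
    (λ i∈ → let j , i≡xj = ∈-image⁻ x (∈-elements⁻ (image x) i∈) in
            subst (_∈ₗ List.tabulate x) (sym i≡xj) (Membership.∈-tabulate⁺ j))
    (λ i∈ → let j , i≡xj = Membership.∈-tabulate⁻ i∈ in
            ∈-elements⁺ (subst (_∈ image x) (sym i≡xj) (∈-image⁺ x j)))

  ∣image∣ : ∣ image x ∣ ≡ n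
  ∣image∣ = trans (sym (length-elements (image x)))
                  (trans (cong length elements-image) (List.length-tabulate x))

word : ∀ {N k} → Digraph.Vertex (Sh N k) → Vec (Fin N) k
word (S , ∣S∣≡k) = Vec.cast (trans (length-elements S) ∣S∣≡k) (Vec.fromList (elements S))

toList-tabulate : ∀ {A : Set} {n} (f : Fin n → A) → Vec.toList (Vec.tabulate f) ≡ List.tabulate f
toList-tabulate {n = zero}  f = refl
toList-tabulate {n = suc n} f = cong (f zero ∷_) (toList-tabulate (f ∘ suc))

word-image : ∀ {N k} {x : Fin k → Fin N} → x Preserves Fin._<_ ⟶ Fin._<_ →
  (S : Digraph.Vertex (Sh N k)) → proj₁ S ≡ image x → word S ≡ Vec.tabulate x
word-image {x = x} x-mono (_ , e) refl = trans (sym (Vec.cast-is-id refl _))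
  (Vec.toList-injective refl _ _ (begin
    Vec.toList (word (image x , e))               ≡⟨ Vec.toList-cast _ (Vec.fromList (elements (image x))) ⟩
    Vec.toList (Vec.fromList (elements (image x))) ≡⟨ Vec.toList∘fromList _ ⟩
    elements (image x)                            ≡⟨ elements-image x-mono ⟩
    List.tabulate x                               ≡⟨ toList-tabulate x ⟨
    Vec.toList (Vec.tabulate x)                   ∎))
  where open ≡-Reasoning

lookup-init : ∀ {A : Set} {n} (w : Vec A (suc n)) i → Vec.lookup (Vec.init w) i ≡ Vec.lookup w (Fin.inject₁ i)
lookup-init (x ∷ y ∷ w) zero    = refl
lookup-init (x ∷ y ∷ w) (suc i) = lookup-init (y ∷ w) i

init-tabulate : ∀ {A : Set} {n} (f : Fin (suc n) → A) →
  Vec.init (Vec.tabulate f) ≡ Vec.tabulate (f ∘ Fin.inject₁)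
init-tabulate {n = zero}  f = refl
init-tabulate {n = suc n} f = cong (f zero ∷_) (init-tabulate (f ∘ suc))

tabulate-increasing : ∀ {N n} {x : Fin n → Fin N} → x Preserves Fin._<_ ⟶ Fin._<_ →
  Increasing (Vec.tabulate x)
tabulate-increasing {n = zero}        _      = []
tabulate-increasing {n = suc zero}    _      = [-]
tabulate-increasing {n = suc (suc n)} x-mono = x-mono (s≤s z≤n) ∷ tabulate-increasing (x-mono ∘ s≤s)

inject₁-mono : ∀ {n} → Fin.inject₁ {n} Preserves Fin._<_ ⟶ Fin._<_
inject₁-mono {_} {i} {j} = subst₂ _<_ (sym (Fin.toℕ-inject₁ i)) (sym (Fin.toℕ-inject₁ j))

lookup-mono : ∀ {N n} {w : Vec (Fin N) n} → Increasing w → Vec.lookup w Preserves Fin._<_ ⟶ Fin._<_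
lookup-mono inc = Linked.lookup⁺ Fin.<-trans inc

module _ {m} (Q : Poset 0ℓ 0ℓ 0ℓ) (anti : IsAntichain Q) (card : HasCardinality Q m) {N k : ℕ} where
  open Poset Q using (Carrier; _≈_; module Eq; reflexive) renaming (_≤_ to _⊑_)
  open Inverse card using (to; from; inverse; to-cong)
  open Digraph (Sh N (suc k)) using (Vertex; Arc)

  shiftHom⇒colourable : ShiftHom N k Q → Colourable (Sh N (suc k)) m
  shiftHom⇒colourable (f , f-hom) = colour , λ
    { u v (inj₁ u→v) → arc {u} {v} u→v
    ; u v (inj₂ v→u) → arc {v} {u} v→u ∘ sym
    }
    where
    colour : Vertex → Fin m
    colour = to ∘ f ∘ word
    arc : ∀ {u v} → Arc u v → colour u ≢ colour v
    arc {u} {v} (x , x-mono , u≡ , v≡) cu≡cv =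
      f-hom (tabulate-increasing x-mono)
        (subst₂ _⊑_
          (cong f (trans (word-image (x-mono ∘ inject₁-mono) u u≡) (sym (init-tabulate x))))
          (cong f (word-image (x-mono ∘ s≤s) v v≡))
          (reflexive (Eq.trans (Eq.sym (proj₂ inverse refl)) (proj₂ inverse cu≡cv))))

  colourable⇒shiftHom : Carrier → Colourable (Sh N (suc k)) m → ShiftHom N k Q
  colourable⇒shiftHom default (c , c-proper) = f , f-hom
    where
    f : Vec (Fin N) (suc k) → Carrier
    -- A vector with repeated entries names no vertex and gets `default`; increasing vectors never
    -- fall into that case.
    f v with ∣ image (Vec.lookup v) ∣ ℕ.≟ suc k
    ... | yes e = from (c (image (Vec.lookup v) , e))
    ... | no  _ = default

    f-vertex : ∀ v → Increasing v → ∃[ e ] f v ≡ from (c (image (Vec.lookup v) , e))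
    f-vertex v inc with ∣ image (Vec.lookup v) ∣ ℕ.≟ suc k
    ... | yes e = e , refl
    ... | no ¬e = contradiction (∣image∣ (lookup-mono inc)) ¬e

    f-hom : ∀ {w} → Increasing w → ¬ f (Vec.init w) ⊑ f (Vec.tail w)
    f-hom {w@(_ ∷ _)} inc p
      with e₁ , eq₁ ← f-vertex (Vec.init w) (init-increasing inc)
         | e₂ , eq₂ ← f-vertex (Vec.tail w) (Linked.tail inc) =
      -- Different colours are incomparable in the antichain. Arcs see only the underlying subsets,
      -- so any size proofs `e₁`, `e₂` will do.
      proj₁ (anti _ _ (λ eq → c-proper _ _
        (inj₁ (Vec.lookup w , lookup-mono inc , image-cong (lookup-init w) , refl))
        (trans (sym (proj₁ inverse Eq.refl)) (proj₁ inverse eq))))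
        (subst₂ _⊑_ eq₁ eq₂ p)

-- Chromatic numbers and the shift number

module _ {m} (Q : Poset 0ℓ 0ℓ 0ℓ) (anti : IsAntichain Q) (card : HasCardinality Q (suc m)) where

  1≤size : ∀ i → 1 ≤ size (suc m) i
  1≤size i = ℕ.≤-trans (s≤s z≤n)
    (Fin.toℕ<n (Realisation.index (realisation Q anti card i) (J^-default Q anti card i)))

  colourable⇔ : ∀ {N} k → Colourable (Sh N (suc k)) (suc m) ⇔ N ≤ size (suc m) k
  colourable⇔ k = mk⇔
    (Equivalence.to (shiftHom⇔ Q anti card k) ∘ colourable⇒shiftHom Q anti card (J^-default Q anti card 0))
    (shiftHom⇒colourable Q anti card ∘ Equivalence.from (shiftHom⇔ Q anti card k))

-- Needed to find the least number of colours. For a positive number the question reduces to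
-- comparing `N` with `size`; with no colours it asks whether there is a vertex.
colourable? : ∀ N k m → Dec (Colourable (Sh N (suc k)) m)
colourable? N k zero with anySubset? (λ (S : Subset N) → ∣ S ∣ ℕ.≟ suc k)
... | yes v  = no λ { (c , _) → contradiction (c v) Fin.¬Fin0 }
... | no  ¬v = yes ((λ v → contradiction v ¬v) , λ u → contradiction u ¬v)
colourable? N k (suc m) = map′ (Equivalence.from equiv) (Equivalence.to equiv) (N ℕ.≤? size (suc m) k)
  where
  equiv : Colourable (Sh N (suc k)) (suc m) ⇔ N ≤ size (suc m) k
  equiv = colourable⇔ (discrete (suc m)) (discrete-antichain (suc m)) (discrete-cardinality (suc m)) k

colourable-mono : ∀ {G m n} → m ≤ n → Colourable G m → Colourable G n
colourable-mono m≤n (c , c-proper) = (λ v → Fin.inject≤ (c v) m≤n) ,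
  λ u v adj eq → c-proper u v adj (Fin.inject≤-injective m≤n m≤n (c u) (c v) eq)

least : ∀ {P : ℕ → Set} → (∀ n → Dec (P n)) → ∀ {n} → P n → ∃[ l ] (IsLeast P l × l ≤ n)
least P? {n} Pn with P? 0
least P? {n}     Pn | yes P0 = 0 , (P0 , λ _ _ → z≤n) , z≤n
least P? {zero}  Pn | no ¬P0 = contradiction Pn ¬P0
least {P} P? {suc n} Pn | no ¬P0 with l , (Pl , l-least) , l≤n ← least (P? ∘ suc) {n} Pn =
  suc l , (Pl , minimal) , s≤s l≤n
  where
  minimal : ∀ j → P j → suc l ≤ j
  minimal zero    P0 = contradiction P0 ¬P0
  minimal (suc j) Pj = s≤s (l-least j Pj)

theorem1p3 : (A₃ : Poset 0ℓ 0ℓ 0ℓ) → IsAntichain A₃ → HasCardinality A₃ 3 →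
    ∀ (k : ℕ) → 1 ≤ k →
    ∃[ s ] (IsShiftNumber₃ k s
    × HasCardinality (J^ (k ∸ 1) A₃) s
    × (5 ≤ k → twr (k ∸ 2) 2 ^ 2 ≤ s × s ≤ twr (k ∸ 1) 2 / 2))
theorem1p3 A₃ anti card (suc i) _ =
  size 3 i , (attained , maximal) , Realisation.cardinality (realisation A₃ anti card i) , bounds
  where
  attained : 1 ≤ size 3 i × ∃[ χ ] (IsChromaticNumber (Sh (size 3 i) (suc i)) χ × χ ≤ 3)
  attained = 1≤size A₃ anti card i ,
    least (colourable? (size 3 i) i) (Equivalence.from (colourable⇔ A₃ anti card i) ℕ.≤-refl)

  maximal : ∀ N → 1 ≤ N × ∃[ χ ] (IsChromaticNumber (Sh N (suc i)) χ × χ ≤ 3) → N ≤ size 3 i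
  maximal N (_ , χ , (χ-colourable , _) , χ≤3) =
    Equivalence.to (colourable⇔ A₃ anti card i) (colourable-mono χ≤3 χ-colourable)

  bounds : 5 ≤ suc i → twr (i ∸ 1) 2 ^ 2 ≤ size 3 i × size 3 i ≤ twr i 2 / 2
  -- Matching makes `i` equal to `4 + j`, so the tower indices k - 2 and k - 1 become 3 + j and 4 +
  -- j.
  bounds (s≤s (s≤s (s≤s (s≤s (s≤s (z≤n {j})))))) = lower j , (begin
    size 3 (4 + j)                ≤⟨ ℕ.n≤1+n _ ⟩
    suc (size 3 (4 + j))          ≡⟨ m*n/n≡m (suc (size 3 (4 + j))) 2 ⟨
    suc (size 3 (4 + j)) * 2 / 2  ≡⟨ cong (_/ 2) (ℕ.*-comm (suc (size 3 (4 + j))) 2) ⟩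
    2 * suc (size 3 (4 + j)) / 2  ≤⟨ /-monoˡ-≤ 2 (upper j) ⟩
    twr (4 + j) 2 / 2             ∎)
    where open ℕ.≤-Reasoning
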